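{- Let $n\ge 1$ and let $R=(r_1,\dots,r_n)$ and $S=(s_1,\dots,s_n)$ be vectors of nonnegative real numbers with $\sum_i r_i=\sum_j s_j$. Then $\mathcal{T}^{+1}(R,S)\neq\emptyset$ if and only if $S=R^r$, where $R^r=(r_n,\dots,r_2,r_1)$ is the reversal of $R$. Likewise, if $R$ and $S$ have nonnegative integer components, then $\mathcal{T}^{+1}_{\mathbb{Z}}(R,S)\neq\emptyset$ if and only if $S=R^r$.
   Context: $\mathcal{T}(R,S)$ is the set of $n\times n$ matrices with nonnegative real entries whose $i$th row sum is $r_i$ and whose $j$th column sum is $s_j$ for all $i,j$. The reflection $r_{+1}$ (in the line of slope $+1$) acts on $n\times n$ matrices as transposition with respect to the antidiagonal: $(r_{+1}A)_{i,j}=a_{n+1-j,\,n+1-i}$. $\mathcal{T}^{+1}(R,S)$ is the set of $A\in\mathcal{T}(R,S)$ with $r_{+1}A=A$; $\mathcal{T}^{+1}_{\mathbb{Z}}(R,S)$ is the set of those $A\in\mathcal{T}^{+1}(R,S)$ all of whose entries are integers. -}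

module Defs where

open import Algebra.Bundles using (CommutativeMonoid)
open import Data.Fin using (opposite)
open import Data.Integer using (ℤ)
open import Data.Nat as ℕ using (ℕ)
import Data.Nat.Properties as ℕ
open import Data.Product using (_×_; _,_; ∃-syntax)
open import Data.Rational as ℚ using (ℚ; 0ℚ; ½; ∣_∣)
import Data.Rational.Properties as ℚ
open import Data.Rational.Solver using (module +-*-Solver)
open import Data.Vec.Functional using (Vector; transpose)
open import Data.Vec.Functional.Relation.Binary.Pointwise using (Pointwise)
open import Data.Vec.Functional.Relation.Unary.All using (All)
open import Level using (0ℓ)
open import Relation.Binary.PropositionalEquality
  using (_≡_; refl; sym; trans; cong; cong₂; subst)
open import Relation.Unary using (Pred; _∩_)

open +-*-Solver

------------------------------------------------------------------------
-- Real numbers: Cauchy sequences of rationals.  Since there are no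
-- quotient types, equality of reals is the relation _≈_ (the difference
-- of the two sequences tends to zero), not _≡_.

Eventually : Pred ℕ 0ℓ → Set
Eventually P = ∃[ N ] (∀ n → n ℕ.≥ N → P n)

IsCauchy : (ℕ → ℚ) → Set
IsCauchy x =
  ∀ ε → 0ℚ ℚ.< ε → ∃[ N ] (∀ m n → m ℕ.≥ N → n ℕ.≥ N → ∣ x m ℚ.- x n ∣ ℚ.< ε)

record ℝ : Set where
  constructor mkℝ
  field
    seq    : ℕ → ℚ
    cauchy : IsCauchy seq

open ℝ public

infix  4 _≈_ _≤_
infixl 6 _+_

_≈_ : ℝ → ℝ → Set
x ≈ y = ∀ ε → 0ℚ ℚ.< ε → Eventually (λ n → ∣ seq x n ℚ.- seq y n ∣ ℚ.< ε)

-- The slack ε is needed: x ≤ y does not force seq x n ≤ seq y n for any n.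
_≤_ : ℝ → ℝ → Set
x ≤ y = ∀ ε → 0ℚ ℚ.< ε → Eventually (λ n → seq x n ℚ.< seq y n ℚ.+ ε)

private
  ∣p-p∣<ε : ∀ p {ε} → 0ℚ ℚ.< ε → ∣ p ℚ.- p ∣ ℚ.< ε
  ∣p-p∣<ε p 0<ε = subst (λ q → ∣ q ∣ ℚ.< _) (sym (ℚ.+-inverseʳ p)) 0<ε

  0<½* : ∀ {ε} → 0ℚ ℚ.< ε → 0ℚ ℚ.< ½ ℚ.* ε
  0<½* {ε} 0<ε = subst (ℚ._< ½ ℚ.* ε) (ℚ.*-zeroʳ ½) (ℚ.*-monoʳ-<-pos ½ 0<ε)

  ½+½ : ∀ ε → ½ ℚ.* ε ℚ.+ ½ ℚ.* ε ≡ ε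
  ½+½ ε = trans (sym (ℚ.*-distribʳ-+ ε ½ ½)) (ℚ.*-identityˡ ε)

  ∣p+q∣<ε : ∀ p q {ε} → ∣ p ∣ ℚ.< ½ ℚ.* ε → ∣ q ∣ ℚ.< ½ ℚ.* ε → ∣ p ℚ.+ q ∣ ℚ.< ε
  ∣p+q∣<ε p q {ε} hp hq = subst (∣ p ℚ.+ q ∣ ℚ.<_) (½+½ ε)
    (ℚ.≤-<-trans (ℚ.∣p+q∣≤∣p∣+∣q∣ p q) (ℚ.+-mono-< hp hq))

  interchange : ∀ a b c d →
    (a ℚ.- b) ℚ.+ (c ℚ.- d) ≡ (a ℚ.+ c) ℚ.- (b ℚ.+ d)
  interchange = solve 4
    (λ a b c d → (a :- b) :+ (c :- d) := (a :+ c) :- (b :+ d)) refl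

  telescope : ∀ a b c → (a ℚ.- b) ℚ.+ (b ℚ.- c) ≡ a ℚ.- c
  telescope = solve 3 (λ a b c → (a :- b) :+ (b :- c) := a :- c) refl

  flip-- : ∀ a b → ℚ.- (a ℚ.- b) ≡ b ℚ.- a
  flip-- = solve 2 (λ a b → :- (a :- b) := b :- a) refl

_+_ : ℝ → ℝ → ℝ
seq    (x + y) n = seq x n ℚ.+ seq y n
cauchy (x + y) ε 0<ε
  with cauchy x (½ ℚ.* ε) (0<½* 0<ε) | cauchy y (½ ℚ.* ε) (0<½* 0<ε)
... | M , hx | N , hy = M ℕ.⊔ N , λ m n m≥ n≥ →
  subst (λ p → ∣ p ∣ ℚ.< ε) (interchange (seq x m) (seq x n) (seq y m) (seq y n))
    (∣p+q∣<ε (seq x m ℚ.- seq x n) (seq y m ℚ.- seq y n)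
      (hx m n (ℕ.m⊔n≤o⇒m≤o M N m≥) (ℕ.m⊔n≤o⇒m≤o M N n≥))
      (hy m n (ℕ.m⊔n≤o⇒n≤o M N m≥) (ℕ.m⊔n≤o⇒n≤o M N n≥)))

fromℚ : ℚ → ℝ
seq    (fromℚ q) _       = q
cauchy (fromℚ q) ε 0<ε = 0 , λ _ _ _ _ → ∣p-p∣<ε q 0<ε

0ℝ : ℝ
0ℝ = fromℚ 0ℚ

fromℤ : ℤ → ℝ
fromℤ z = fromℚ (z ℚ./ 1)

NonNegative : Pred ℝ 0ℓ
NonNegative x = 0ℝ ≤ x

IsInteger : Pred ℝ 0ℓ
IsInteger x = ∃[ z ] x ≈ fromℤ z

≈-pointwise : ∀ {x y} → (∀ n → seq x n ≡ seq y n) → x ≈ y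
≈-pointwise {x} {y} eq ε 0<ε = 0 , λ n _ →
  subst (λ p → ∣ seq x n ℚ.- p ∣ ℚ.< ε) (eq n) (∣p-p∣<ε (seq x n) 0<ε)

≈-refl : ∀ {x} → x ≈ x
≈-refl {x} = ≈-pointwise {x} {x} (λ _ → refl)

≈-sym : ∀ {x y} → x ≈ y → y ≈ x
≈-sym {x} {y} x≈y ε 0<ε with x≈y ε 0<ε
... | N , h = N , λ n n≥ → subst (ℚ._< ε)
  (trans (sym (ℚ.∣-p∣≡∣p∣ (seq x n ℚ.- seq y n)))
         (cong ∣_∣ (flip-- (seq x n) (seq y n))))
  (h n n≥)

≈-trans : ∀ {x y z} → x ≈ y → y ≈ z → x ≈ z
≈-trans {x} {y} {z} x≈y y≈z ε 0<ε
  with x≈y (½ ℚ.* ε) (0<½* 0<ε) | y≈z (½ ℚ.* ε) (0<½* 0<ε)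
... | M , f | N , g = M ℕ.⊔ N , λ n n≥ →
  subst (λ p → ∣ p ∣ ℚ.< ε) (telescope (seq x n) (seq y n) (seq z n))
    (∣p+q∣<ε (seq x n ℚ.- seq y n) (seq y n ℚ.- seq z n)
      (f n (ℕ.m⊔n≤o⇒m≤o M N n≥)) (g n (ℕ.m⊔n≤o⇒n≤o M N n≥)))

+-cong : ∀ {x y u v} → x ≈ y → u ≈ v → x + u ≈ y + v
+-cong {x} {y} {u} {v} x≈y u≈v ε 0<ε
  with x≈y (½ ℚ.* ε) (0<½* 0<ε) | u≈v (½ ℚ.* ε) (0<½* 0<ε)
... | M , f | N , g = M ℕ.⊔ N , λ n n≥ →
  subst (λ p → ∣ p ∣ ℚ.< ε) (interchange (seq x n) (seq y n) (seq u n) (seq v n))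
    (∣p+q∣<ε (seq x n ℚ.- seq y n) (seq u n ℚ.- seq v n)
      (f n (ℕ.m⊔n≤o⇒m≤o M N n≥)) (g n (ℕ.m⊔n≤o⇒n≤o M N n≥)))

ℝ-+-0-commutativeMonoid : CommutativeMonoid 0ℓ 0ℓ
ℝ-+-0-commutativeMonoid = record
  { Carrier = ℝ
  ; _≈_     = _≈_
  ; _∙_     = _+_
  ; ε       = 0ℝ
  ; isCommutativeMonoid = record
    { isMonoid = record
      { isSemigroup = record
        { isMagma = record
          { isEquivalence = record
            { refl  = λ {x} → ≈-refl {x}
            ; sym   = λ {x} {y} → ≈-sym {x} {y}
            ; trans = λ {x} {y} {z} → ≈-trans {x} {y} {z}
            }
          ; ∙-cong = λ {x} {y} {u} {v} → +-cong {x} {y} {u} {v}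
          }
        ; assoc = λ x y z → ≈-pointwise {(x + y) + z} {x + (y + z)}
            (λ n → ℚ.+-assoc (seq x n) (seq y n) (seq z n))
        }
      ; identity =
          (λ x → ≈-pointwise {0ℝ + x} {x} (λ n → ℚ.+-identityˡ (seq x n)))
        , (λ x → ≈-pointwise {x + 0ℝ} {x} (λ n → ℚ.+-identityʳ (seq x n)))
      }
    ; comm = λ x y → ≈-pointwise {x + y} {y + x}
        (λ n → ℚ.+-comm (seq x n) (seq y n))
    }
  }

open import Algebra.Properties.CommutativeMonoid.Sum ℝ-+-0-commutativeMonoid public
  using (sum)

------------------------------------------------------------------------
-- Matrices, as vectors of rows

Matrix : ℕ → Set
Matrix n = Vector (Vector ℝ n) n

infix 4 _≈ᵥ_ _≈ₘ_

_≈ᵥ_ : ∀ {n} → Vector ℝ n → Vector ℝ n → Set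
_≈ᵥ_ = Pointwise _≈_

_≈ₘ_ : ∀ {n} → Matrix n → Matrix n → Set
_≈ₘ_ = Pointwise _≈ᵥ_

-- With indices starting at 0, `opposite i` is the 1-based index n + 1 - i.
r₊₁ : ∀ {n} → Matrix n → Matrix n
r₊₁ A i j = A (opposite j) (opposite i)

𝒯 : ∀ {n} → Vector ℝ n → Vector ℝ n → Pred (Matrix n) 0ℓ
𝒯 R S A = All (All NonNegative) A
        × (∀ i → sum (A i) ≈ R i)
        × (∀ j → sum (transpose A j) ≈ S j)

𝒯⁺¹ : ∀ {n} → Vector ℝ n → Vector ℝ n → Pred (Matrix n) 0ℓ
𝒯⁺¹ R S = 𝒯 R S ∩ (λ A → r₊₁ A ≈ₘ A)

𝒯⁺¹ℤ : ∀ {n} → Vector ℝ n → Vector ℝ n → Pred (Matrix n) 0ℓ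
𝒯⁺¹ℤ R S = 𝒯⁺¹ R S ∩ All (All IsInteger)

{-# OPTIONS --safe #-}
module Submission where

open import Defs
open import Algebra.Bundles using (CommutativeMonoid)
import Algebra.Properties.CommutativeMonoid.Sum as Sum
open import Data.Bool using (if_then_else_)
open import Data.Fin using (Fin; opposite; punchIn; _≟_)
open import Data.Fin.Permutation using () renaming (reverse to reverseᵖ)
open import Data.Fin.Properties using (opposite-involutive; punchInᵢ≢i)
import Data.Integer as ℤ
open import Data.Nat using (ℕ; _≥_)
open import Data.Product using (_×_; _,_)
import Data.Rational as ℚ
import Data.Rational.Properties as ℚ
open import Data.Vec.Functional using (Vector; reverse; transpose)
open import Data.Vec.Functional.Relation.Unary.All using (All)
open import Function using (_∘_)
open import Function.Bundles using (_⇔_; mk⇔)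
open import Level using (0ℓ)
open import Relation.Binary.PropositionalEquality
  using (_≡_; _≢_; refl; sym; trans; cong; subst)
open import Relation.Nullary using (yes; no; does; contradiction)
open import Relation.Unary using (Pred; Satisfiable)

-- The reflection sends row `opposite j` to column `j`, reversing the order of its entries. In a
-- matrix that it fixes, these two lines therefore have equal sums, which forces `S ≈ᵥ reverse R`.
-- Conversely, put `R` on the antidiagonal and zero elsewhere. Each row and each column meets the
-- antidiagonal once, so the row sums are `R` and the column sums its reversal. The reflection fixes
-- every antidiagonal position. All entries are zero or components of `R`, so this one matrix
-- settles both the real and the integer case.

module _ {c ℓ} (M : CommutativeMonoid c ℓ) where

  private module M = CommutativeMonoid M
  open Sum M using (sum-remove; sum-cong-≋; sum-replicate-zero; sum-permute)
    renaming (sum to Σ)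

  sum-single : ∀ {n} (t : Vector M.Carrier n) i →
    (∀ j → j ≢ i → t j M.≈ M.ε) → Σ t M.≈ t i
  sum-single {ℕ.suc n} t i t≈ε = M.trans (sum-remove {i = i} t)
    (M.trans (M.∙-congˡ (M.trans (sum-cong-≋ (λ j → t≈ε (punchIn i j) (punchInᵢ≢i i j)))
                                 (sum-replicate-zero n)))
             (M.identityʳ (t i)))

  sum-reverse : ∀ {n} (t : Vector M.Carrier n) → Σ (reverse t) M.≈ Σ t
  sum-reverse t = M.sym (sum-permute t reverseᵖ)

opposite-swap : ∀ {n} {i j : Fin n} → opposite i ≡ j → opposite j ≡ i
opposite-swap {i = i} refl = opposite-involutive i

antidiagonal : ∀ {n} → Vector ℝ n → Matrix n
antidiagonal R i j = if does (opposite i ≟ j) then R i else 0ℝ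

antidiagonal-on : ∀ {n} (R : Vector ℝ n) {i j} →
  opposite i ≡ j → antidiagonal R i j ≡ R i
antidiagonal-on R {i} {j} eq with opposite i ≟ j
... | yes _  = refl
... | no neq = contradiction eq neq

antidiagonal-off : ∀ {n} (R : Vector ℝ n) {i j} →
  opposite i ≢ j → antidiagonal R i j ≡ 0ℝ
antidiagonal-off R {i} {j} neq with opposite i ≟ j
... | yes eq = contradiction eq neq
... | no _   = refl

-- Kept general in `P` so as to give both nonnegativity and integrality of the entries.
antidiagonal-All : ∀ {n} {P : Pred ℝ 0ℓ} {R : Vector ℝ n} →
  P 0ℝ → All P R → All (All P) (antidiagonal R)
antidiagonal-All p0 pR i j with opposite i ≟ j
... | yes _ = pR i
... | no _  = p0

≡⇒≈ : ∀ {x y} → x ≡ y → x ≈ y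
≡⇒≈ {x} refl = ≈-refl {x}

antidiagonal-row : ∀ {n} (R : Vector ℝ n) i → sum (antidiagonal R i) ≈ R i
antidiagonal-row R i = subst (sum (antidiagonal R i) ≈_) (antidiagonal-on R refl)
  (sum-single ℝ-+-0-commutativeMonoid (antidiagonal R i) (opposite i)
    (λ j j≢ → ≡⇒≈ (antidiagonal-off R (j≢ ∘ sym))))

-- Column `j` meets the antidiagonal in row `opposite j`; this is where the reversal comes from.
antidiagonal-column : ∀ {n} (R : Vector ℝ n) j →
  sum (transpose (antidiagonal R) j) ≈ reverse R j
antidiagonal-column R j = subst (sum (transpose (antidiagonal R) j) ≈_)
  (antidiagonal-on R (opposite-involutive j))
  (sum-single ℝ-+-0-commutativeMonoid (transpose (antidiagonal R) j) (opposite j)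
    (λ i i≢ → ≡⇒≈ (antidiagonal-off R (i≢ ∘ sym ∘ opposite-swap))))

antidiagonal-symmetric : ∀ {n} (R : Vector ℝ n) →
  r₊₁ (antidiagonal R) ≈ₘ antidiagonal R
antidiagonal-symmetric R i j with opposite i ≟ j
-- The reflected entry lies in row `opposite j`, which is row `i` itself on the antidiagonal.
... | yes eq = ≡⇒≈ (trans (antidiagonal-on R (cong opposite (opposite-swap eq)))
                         (cong R (opposite-swap eq)))
-- `opposite` is an involution, so a position off the antidiagonal stays off it when reflected.
... | no neq = ≡⇒≈ (antidiagonal-off R
  (λ eq → neq (trans (sym eq) (opposite-involutive j))))

antidiagonal-∈-𝒯⁺¹ : ∀ {n} (R S : Vector ℝ n) → All NonNegative R →
  S ≈ᵥ reverse R → 𝒯⁺¹ R S (antidiagonal R)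
antidiagonal-∈-𝒯⁺¹ R S R≥0 S≈ =
  ( antidiagonal-All {P = NonNegative} 0≤0 R≥0
  , antidiagonal-row R
  , λ j → ≈-trans {sum (transpose (antidiagonal R) j)} {reverse R j} {S j}
      (antidiagonal-column R j) (≈-sym {S j} {reverse R j} (S≈ j))
  ) , antidiagonal-symmetric R
  where
  0≤0 : NonNegative 0ℝ
  -- With the slack in `_≤_` the claim is 0 < 0 + ε, true from index 0 on.
  0≤0 ε 0<ε = 0 , λ _ _ → subst (_ ℚ.<_) (sym (ℚ.+-identityˡ ε)) 0<ε

-- Reflection in the antidiagonal turns column j into the reversal of row n + 1 - j.
𝒯⁺¹⇒S≈reverse-R : ∀ {n} (R S : Vector ℝ n) A → 𝒯⁺¹ R S A → S ≈ᵥ reverse R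
𝒯⁺¹⇒S≈reverse-R R S A ((_ , rows , columns) , symmetric) j = begin
  S j                            ≈⟨ columns j ⟨
  sum (transpose A j)            ≈⟨ sum-cong-≋ {x = reverse (A (opposite j))} {transpose A j}
                                      (λ i → symmetric i j) ⟨
  sum (reverse (A (opposite j))) ≈⟨ sum-reverse ℝ-+-0-commutativeMonoid (A (opposite j)) ⟩
  sum (A (opposite j))           ≈⟨ rows (opposite j) ⟩
  reverse R j                    ∎
  where
  open Sum ℝ-+-0-commutativeMonoid using (sum-cong-≋)
  open import Relation.Binary.Reasoning.Setoid
    (CommutativeMonoid.setoid ℝ-+-0-commutativeMonoid)

theorem4 : (n : ℕ) → n ≥ 1 →
    (R S : Vector ℝ n) → All NonNegative R → All NonNegative S →
    sum R ≈ sum S →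
    (Satisfiable (𝒯⁺¹ R S) ⇔ S ≈ᵥ reverse R)
    × (All IsInteger R → All IsInteger S →
    (Satisfiable (𝒯⁺¹ℤ R S) ⇔ S ≈ᵥ reverse R))
theorem4 n _ R S R≥0 _ _ =
    mk⇔ (λ (A , A∈𝒯) → 𝒯⁺¹⇒S≈reverse-R R S A A∈𝒯)
        (λ S≈ → antidiagonal R , antidiagonal-∈-𝒯⁺¹ R S R≥0 S≈)
  , λ R∈ℤ _ →
    mk⇔ (λ (A , A∈𝒯 , _) → 𝒯⁺¹⇒S≈reverse-R R S A A∈𝒯)
        (λ S≈ → antidiagonal R , antidiagonal-∈-𝒯⁺¹ R S R≥0 S≈ ,
                -- Reflexivity suffices for the zero entries, as `fromℤ ℤ.0ℤ` computes to `0ℝ`.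
                antidiagonal-All {P = IsInteger} (ℤ.0ℤ , ≈-refl {0ℝ}) R∈ℤ)
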